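{- Let $F$, $G$, and $H$ be simple graphs. Then \[\hom(F,G\cdot H)=\sum_{\mathcal{R}}\hom(F/\mathcal{R},G)\,\hom\Big(\coprod_{R\in\mathcal{R}}F[R],H\Big),\] where the sum ranges over all partitions $\mathcal{R}$ of $V(F)$ such that $F[R]$ is connected for all $R\in\mathcal{R}$.
   Context: All graphs are finite, undirected, without multiple edges; simple means without loops. $\hom(F,G)$ counts homomorphisms $F\to G$. $G\cdot H$ is the lexicographic product: vertex set $V(G)\times V(H)$, with $(g,h)$ adjacent to $(g',h')$ iff $g=g'$ and $hh'\in E(H)$, or $gg'\in E(G)$. $F[R]$ is the subgraph induced by $R$; $\coprod$ is disjoint union. For a partition $\mathcal{R}$ of $V(F)$, $F/\mathcal{R}$ is the simple graph with vertex set $\mathcal{R}$ and an edge $PQ$ ($P\ne Q$) iff some $p\in P$ and $q\in Q$ are adjacent in $F$. -}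

module Defs where

open import Data.Fin using (Fin; zero; suc; finToFun)
import Data.Fin.Properties as Fin
open import Data.Fin.Properties using (+↔⊎; *↔×)
open import Data.Fin.Subset
  using (Subset; inside; outside; _∈_; _⊃_; _∪_; _∩_; ⁅_⁆; Nonempty; Empty)
open import Data.Fin.Subset.Induction using (⊃-wellFounded)
open import Data.Fin.Subset.Properties
  using (_∈?_; nonempty?; x∈⁅x⁆; x∈⁅y⁆⇒x≡y; x∈p∪q⁻; p⊆p∪q; q⊆p∪q)
open import Data.List
  using (List; []; _∷_; _++_; map; filter; length; lookup; allFin)
open import Data.List.Relation.Unary.All using (All; all?)
open import Data.List.Relation.Unary.AllPairs using (AllPairs; allPairs?)
open import Data.List.Relation.Unary.Any using (Any; any?)
open import Data.Nat using (ℕ; zero; suc; _+_; _*_; _^_)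
open import Data.Product using (Σ; Σ-syntax; ∃; ∃-syntax; _×_; _,_; proj₁; proj₂)
open import Data.Product.Function.Dependent.Propositional using (Σ-↔)
open import Data.Product.Function.NonDependent.Propositional using (_×-↔_)
open import Data.Sum using (_⊎_; inj₁; inj₂)
open import Data.Sum.Function.Propositional using (_⊎-↔_)
open import Data.Vec using () renaming ([] to []ᵛ; _∷_ to _∷ᵛ_)
open import Data.Vec.Properties.WithK using ([]=-irrelevant)
open import Function using (_∘_; _↔_; Injection; Inverse; mk↔ₛ′)
open import Function.Construct.Composition using (_↔-∘_)
open import Function.Construct.Identity using (↔-id)
open import Function.Construct.Symmetry using (↔-sym)
open import Function.Properties.Inverse using (Inverse⇒Injection)
open import Induction.WellFounded using (Acc; acc)
open import Level using (0ℓ)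
open import Relation.Binary using (Rel; Decidable; Symmetric; Irreflexive; DecidableEquality)
open import Relation.Binary.Construct.Closure.ReflexiveTransitive
  using (Star; ε; _◅_; _◅◅_)
open import Relation.Binary.PropositionalEquality
  using (_≡_; _≢_; refl; sym; subst)
open import Relation.Nullary using (Dec; yes; no; ¬?; contradiction)
open import Relation.Nullary.Decidable
  using (map′; _×-dec_; _⊎-dec_; _→-dec_; via-injection)
import Relation.Unary as U

Finite : Set → Set
Finite A = Σ[ n ∈ ℕ ] A ↔ Fin n

private
  variable
    A B : Set

module _ (fin : Finite A) where

  open Inverse (proj₂ fin)

  finite-≟ : DecidableEquality A
  finite-≟ = via-injection (Inverse⇒Injection (proj₂ fin)) Fin._≟_

  finite-any? : {P : A → Set} → U.Decidable P → Dec (∃ P)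
  finite-any? {P} P? = map′
    (λ (i , p) → from i , p)
    (λ (a , p) → to a , subst P (sym (strictlyInverseʳ a)) p)
    (Fin.any? (P? ∘ from))

  finite-all? : {P : A → Set} → U.Decidable P → Dec (∀ a → P a)
  finite-all? {P} P? = map′
    (λ f a → subst P (strictlyInverseʳ a) (f (to a)))
    (λ f i → f (from i))
    (Fin.all? (P? ∘ from))

finite-Fin : ∀ n → Finite (Fin n)
finite-Fin n = n , ↔-id (Fin n)

finite-× : Finite A → Finite B → Finite (A × B)
finite-× (m , f) (n , g) = m * n , ↔-sym *↔× ↔-∘ (f ×-↔ g)

finite-prop : (∀ (x y : A) → x ≡ y) → Dec A → Finite A
finite-prop irr (yes a) =
  1 , mk↔ₛ′ (λ _ → zero) (λ _ → a) (λ { zero → refl }) (irr a)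
finite-prop irr (no ¬a) =
  0 , mk↔ₛ′ (λ a → contradiction a ¬a) (λ ()) (λ ()) (λ a → contradiction a ¬a)

finite-ΣFin : ∀ n {P : Fin n → Set} → (∀ i → Finite (P i)) → Finite (Σ (Fin n) P)
finite-ΣFin zero    fin = 0 , mk↔ₛ′ proj₁ (λ ()) (λ ()) (λ ())
finite-ΣFin (suc n) {P} fin =
  let m , f = fin zero
      k , g = finite-ΣFin n (fin ∘ suc)
  in m + k , ↔-sym +↔⊎ ↔-∘ ((f ⊎-↔ g) ↔-∘ split)
  where
  split : Σ (Fin (suc n)) P ↔ (P zero ⊎ Σ (Fin n) (P ∘ suc))
  split = mk↔ₛ′
    (λ { (zero , p) → inj₁ p ; (suc i , p) → inj₂ (i , p) })
    (λ { (inj₁ p) → zero , p ; (inj₂ (i , p)) → suc i , p })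
    (λ { (inj₁ _) → refl ; (inj₂ _) → refl })
    (λ { (zero , _) → refl ; (suc _ , _) → refl })

finite-∈ : ∀ {n} (i : Fin n) (p : Subset n) → Finite (i ∈ p)
finite-∈ i p = finite-prop []=-irrelevant (i ∈? p)

finite-sub : (fin : Finite A) (p : Subset (proj₁ fin)) →
             Finite (Σ[ a ∈ A ] Inverse.to (proj₂ fin) a ∈ p)
finite-sub (n , f) p =
  let m , g = finite-ΣFin n (λ i → finite-∈ i p)
  in m , g ↔-∘ Σ-↔ f (↔-id _)

record Graph : Set₁ where
  infix 4 _~_ _~?_
  field
    V      : Set
    finite : Finite V
    _~_    : Rel V 0ℓ
    ~-sym  : Symmetric _~_
    _~?_   : Decidable _~_

  order : ℕ
  order = proj₁ finite

  open Inverse (proj₂ finite) public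
    using () renaming (to to index; from to vertex)

  index-injective : ∀ {u v} → index u ≡ index v → u ≡ v
  index-injective = Injection.injective (Inverse⇒Injection (proj₂ finite))

  _≟_ : DecidableEquality V
  _≟_ = finite-≟ finite

open Graph using (V; order)

-- Loops are allowed in a Graph and excluded here; multiple edges do not arise
-- because only the truth of u ~ v matters.
Simple : Graph → Set
Simple G = Irreflexive _≡_ (Graph._~_ G)

IsHom : (F G : Graph) → (V F → V G) → Set
IsHom F G f = ∀ u v → Graph._~_ F u v → Graph._~_ G (f u) (f v)

isHom? : ∀ F G → U.Decidable (IsHom F G)
isHom? F G f =
  finite-all? F.finite λ u → finite-all? F.finite λ v →
    (u F.~? v) →-dec (f u G.~? f v)
  where
  module F = Graph F
  module G = Graph G

-- finToFun is a bijection (up to pointwise equality) from the codes onto the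
-- maps Fin (order F) → Fin (order G), so each map V F → V G has one code.
decodeMap : (F G : Graph) → Fin (order G ^ order F) → V F → V G
decodeMap F G c = Graph.vertex G ∘ finToFun c ∘ Graph.index F

hom : Graph → Graph → ℕ
hom F G = length (filter (isHom? F G ∘ decodeMap F G) (allFin (order G ^ order F)))

infixl 7 _·_

_·_ : Graph → Graph → Graph
G · H = record
  { V      = G.V × H.V
  ; finite = finite-× G.finite H.finite
  ; _~_    = λ (g , h) (g′ , h′) → (g ≡ g′ × h H.~ h′) ⊎ g G.~ g′
  ; ~-sym  = λ { (inj₁ (e , a)) → inj₁ (sym e , H.~-sym a)
               ; (inj₂ a)       → inj₂ (G.~-sym a) }
  ; _~?_   = λ (g , h) (g′ , h′) →
               ((g G.≟ g′) ×-dec (h H.~? h′)) ⊎-dec (g G.~? g′)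
  }
  where
  module G = Graph G
  module H = Graph H

-- A set of vertices of F is a Subset (order F), read through Graph.index.
VertexSet : Graph → Set
VertexSet F = Subset (order F)

infix 8 _[_]

_[_] : (F : Graph) → VertexSet F → Graph
F [ R ] = record
  { V      = Σ[ v ∈ F.V ] F.index v ∈ R
  ; finite = finite-sub F.finite R
  ; _~_    = λ (u , _) (v , _) → u F.~ v
  ; ~-sym  = F.~-sym
  ; _~?_   = λ (u , _) (v , _) → u F.~? v
  }
  where module F = Graph F

data ∐Adj {k : ℕ} (Gs : Fin k → Graph) : Rel (Σ[ i ∈ Fin k ] V (Gs i)) 0ℓ where
  within : ∀ i {u v} → Graph._~_ (Gs i) u v → ∐Adj Gs (i , u) (i , v)

∐ : ∀ {k} → (Fin k → Graph) → Graph
∐ {k} Gs = record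
  { V      = Σ[ i ∈ Fin k ] V (Gs i)
  ; finite = finite-ΣFin k (λ i → Graph.finite (Gs i))
  ; _~_    = ∐Adj Gs
  ; ~-sym  = λ { (within i a) → within i (Graph.~-sym (Gs i) a) }
  ; _~?_   = adj?
  }
  where
  adj? : Decidable (∐Adj Gs)
  adj? (i , u) (j , v) with i Fin.≟ j
  ... | yes refl = map′ (within i) (λ { (within _ a) → a }) (Graph._~?_ (Gs i) u v)
  ... | no i≢j   = no λ { (within _ _) → i≢j refl }

-- The vertices of F / ℛ are the positions in ℛ.  When ℛ is a partition its
-- entries are nonempty and disjoint, so distinct positions are distinct parts.
infixl 7 _/_

_/_ : (F : Graph) → List (VertexSet F) → Graph
F / ℛ = record
  { V      = Fin (length ℛ)
  ; finite = finite-Fin (length ℛ)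
  ; _~_    = λ P Q → P ≢ Q × ∃[ p ] ∃[ q ] p ∈ᵖ P × q ∈ᵖ Q × p F.~ q
  ; ~-sym  = λ (P≢Q , p , q , p∈P , q∈Q , a) →
               P≢Q ∘ sym , q , p , q∈Q , p∈P , F.~-sym a
  ; _~?_   = λ P Q → ¬? (P Fin.≟ Q) ×-dec
               finite-any? F.finite λ p → finite-any? F.finite λ q →
                 (p ∈ᵖ? P) ×-dec (q ∈ᵖ? Q) ×-dec (p F.~? q)
  }
  where
  module F = Graph F

  _∈ᵖ_ : F.V → Fin (length ℛ) → Set
  v ∈ᵖ P = F.index v ∈ lookup ℛ P

  _∈ᵖ?_ : Decidable _∈ᵖ_
  v ∈ᵖ? P = F.index v ∈? lookup ℛ P

-- The empty graph counts as connected here; this is immaterial for the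
-- induced subgraphs on the parts of a partition, which are nonempty.
Connected : Graph → Set
Connected G = ∀ u v → Star (Graph._~_ G) u v

module _ (G : Graph) where

  open Graph G hiding (V)

  private
    -- Enlarge a set S of vertices reachable from u until no edge leaves it.
    reach : ∀ u (S : VertexSet G) → index u ∈ S →
            (∀ v → index v ∈ S → Star _~_ u v) →
            Acc _⊃_ S → ∀ v → Dec (Star _~_ u v)
    reach u S u∈S sound (acc rec) v
      with finite-any? finite (λ x → finite-any? finite (λ y →
             (index x ∈? S) ×-dec ¬? (index y ∈? S) ×-dec (x ~? y)))
    ... | yes (x , y , x∈S , y∉S , x~y) =
      reach u S′ (p⊆p∪q ⁅ index y ⁆ u∈S) sound′
        (rec (p⊆p∪q ⁅ index y ⁆ , index y , q⊆p∪q S _ (x∈⁅x⁆ _) , y∉S)) v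
      where
      S′ : VertexSet G
      S′ = S ∪ ⁅ index y ⁆

      sound′ : ∀ w → index w ∈ S′ → Star _~_ u w
      sound′ w w∈S′ with x∈p∪q⁻ S _ w∈S′
      ... | inj₁ w∈S = sound w w∈S
      ... | inj₂ w∈y =
        subst (Star _~_ u)
              (sym (index-injective (x∈⁅y⁆⇒x≡y _ w∈y)))
              (sound x x∈S ◅◅ x~y ◅ ε)
    ... | no closed = map′ (sound v) (complete u∈S) (index v ∈? S)
      where
      complete : ∀ {w} → index w ∈ S → Star _~_ w v → index v ∈ S
      complete w∈S ε = w∈S
      complete {w} w∈S (_◅_ {j = z} w~z zv) with index z ∈? S
      ... | yes z∈S = complete z∈S zv
      ... | no  z∉S = contradiction (w , z , w∈S , z∉S , w~z) closed

  connected? : Dec (Connected G)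
  connected? = finite-all? finite λ u → finite-all? finite λ v →
    reach u ⁅ index u ⁆ (x∈⁅x⁆ _)
      (λ w w∈u → subst (Star _~_ u)
        (sym (index-injective (x∈⁅y⁆⇒x≡y _ w∈u))) ε)
      (⊃-wellFounded _) v

record IsPartition {n : ℕ} (ℛ : List (Subset n)) : Set where
  constructor mkPartition
  field
    nonempty : All Nonempty ℛ
    disjoint : AllPairs (λ P Q → Empty (P ∩ Q)) ℛ
    covering : ∀ i → Any (i ∈_) ℛ

isPartition? : ∀ {n} → U.Decidable (IsPartition {n})
isPartition? ℛ = map′
  (λ (a , b , c) → mkPartition a b c)
  (λ (mkPartition a b c) → a , b , c)
  (all? nonempty? ℛ
     ×-dec allPairs? (λ P Q → ¬? (nonempty? (P ∩ Q))) ℛ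
     ×-dec Fin.all? (λ i → any? (i ∈?_) ℛ))

ConnectedPartition : (F : Graph) → List (VertexSet F) → Set
ConnectedPartition F ℛ = IsPartition ℛ × All (λ R → Connected (F [ R ])) ℛ

connectedPartition? : ∀ F → U.Decidable (ConnectedPartition F)
connectedPartition? F ℛ = isPartition? ℛ ×-dec all? (λ R → connected? (F [ R ])) ℛ

allSubsets : ∀ n → List (Subset n)
allSubsets zero    = []ᵛ ∷ []
allSubsets (suc n) = map (outside ∷ᵛ_) (allSubsets n) ++ map (inside ∷ᵛ_) (allSubsets n)

sublists : List A → List (List A)
sublists []       = [] ∷ []
sublists (x ∷ xs) = sublists xs ++ map (x ∷_) (sublists xs)

-- A set of vertex sets is represented by the sublist of allSubsets consisting
-- of its members, so that every partition is listed exactly once.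
connectedPartitions : (F : Graph) → List (List (VertexSet F))
connectedPartitions F =
  filter (connectedPartition? F) (sublists (allSubsets (order F)))

∐-parts : (F : Graph) → List (VertexSet F) → Graph
∐-parts F ℛ = ∐ {length ℛ} λ i → F [ lookup ℛ i ]

{-# OPTIONS --safe #-}

-- A homomorphism f = (g , h) from F to G · H determines the partition of V(F)
-- into the connected components of the subgraph whose edges are the edges uv of
-- F with g u ≡ g v.  On each component g is constant, so g factors through
-- F / ℛ, and h is a homomorphism on every F [ R ] because G has no loops.
-- Conversely, given a partition into connected parts, homomorphisms from F / ℛ
-- and from ∐ F [ R ] glue to a homomorphism to G · H.  As G has no loops,
-- adjacent vertices in different parts get different G-coordinates, so the parts
-- are exactly the components of the glued map and the two constructions are
-- mutually inverse.
module Submission where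

open import Defs
open import Data.Fin using (Fin; zero; suc; combine; finToFun; funToFin)
import Data.Fin.Properties as Fin
open import Data.Fin.Subset
  using (Subset; inside; outside; _∈_; _⊆_; _⊃_; _∪_; _∩_; ⁅_⁆; Nonempty; Empty)
open import Data.Fin.Subset.Induction using (⊃-wellFounded)
open import Data.Fin.Subset.Properties
  using (_∈?_; nonempty?; x∈⁅x⁆; x∈⁅y⁆⇒x≡y; x∈p∪q⁻; p⊆p∪q; q⊆p∪q; x∈p∩q⁺; x∈p∩q⁻;
         ⊆-antisym)
open import Data.List
  using (List; []; _∷_; _++_; map; concatMap; cartesianProduct; filter; length; lookup; allFin)
open import Data.List.Membership.Propositional using (find; lose) renaming (_∈_ to _∈ˡ_)
open import Data.List.Membership.Propositional.Properties
  using (∈-++⁺ˡ; ∈-++⁺ʳ; ∈-++⁻; ∈-map⁺; ∈-map⁻; ∈-filter⁺; ∈-filter⁻; ∈-allFin; ∈-lookup;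
         ∈-concatMap⁺; ∈-concatMap⁻; ∈-cartesianProduct⁺; ∈-cartesianProduct⁻)
open import Data.List.Properties
  using (length-++; length-map; map-cong; filter-accept; filter-reject)
import Data.List.Relation.Unary.All as All
open All using (All; []; _∷_)
open import Data.List.Relation.Unary.AllPairs using (AllPairs; []; _∷_)
open import Data.List.Relation.Unary.Any as Any using (here; there)
open import Data.List.Relation.Unary.Any.Properties using (lookup-index)
open import Data.List.Relation.Unary.Unique.Propositional using (Unique)
import Data.List.Relation.Unary.Unique.Propositional.Properties as Unique
open import Data.Nat using (zero; suc; _+_; _*_; _^_; _≤_)
open import Data.Nat.ListAction using (sum)
open import Data.Nat.Properties using (≤-antisym)
open import Data.Product using (Σ; Σ-syntax; ∃-syntax; _×_; _,_; proj₁; proj₂)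
open import Data.Sum using (inj₁; inj₂)
import Data.Vec as Vec
open import Data.Vec.Properties using (∷-injectiveʳ)
open import Data.Vec.Properties.WithK using ([]=-irrelevant)
open import Function using (_∘_; Inverse)
open import Induction.WellFounded using (Acc; acc)
open import Relation.Binary using (DecidableEquality; Symmetric)
open import Relation.Binary.Construct.Closure.ReflexiveTransitive as Star
  using (Star; ε; _◅_; _◅◅_)
open import Relation.Binary.PropositionalEquality
  using (_≡_; _≢_; refl; sym; trans; cong; cong₂; subst; subst₂)
open import Relation.Nullary using (¬_; yes; no; ¬?; contradiction)
open import Relation.Nullary.Decidable using (map′; _×-dec_; _→-dec_)
open import Relation.Unary using (Decidable)

open Graph using (V; order)

private
  variable
    A B : Set

-- Comparing lengths of lists through a relation.

AllPairs-lookup : {R : A → A → Set} → Symmetric R → ∀ {xs} → AllPairs R xs →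
                  ∀ {i j} → i ≢ j → R (lookup xs i) (lookup xs j)
AllPairs-lookup R-sym (_ ∷ _)   {zero}  {zero}  i≢j = contradiction refl i≢j
AllPairs-lookup R-sym (rx ∷ _)  {zero}  {suc j} _   = All.lookup rx (∈-lookup j)
AllPairs-lookup R-sym (rx ∷ _)  {suc i} {zero}  _   = R-sym (All.lookup rx (∈-lookup i))
AllPairs-lookup R-sym (_ ∷ rxs) {suc i} {suc j} i≢j =
  AllPairs-lookup R-sym rxs (i≢j ∘ cong suc)

Unique-lookup-injective : {xs : List A} → Unique xs →
                          ∀ {i j} → lookup xs i ≡ lookup xs j → i ≡ j
Unique-lookup-injective xs! {i} {j} eq with i Fin.≟ j
... | yes i≡j = i≡j
... | no  i≢j = contradiction eq (AllPairs-lookup (λ x≢y → x≢y ∘ sym) xs! i≢j)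

-- Choosing for each entry of `xs` a related entry of `ys` gives a map of positions. Two positions
-- with the same image carry entries related to the same `y`, so they agree because `xs` has no
-- repetition.
length-≤ : {T : A → B → Set} {xs : List A} {ys : List B} → Unique xs →
           (∀ {x} → x ∈ˡ xs → ∃[ y ] y ∈ˡ ys × T x y) →
           (∀ {x x′ y} → x ∈ˡ xs → x′ ∈ˡ xs → y ∈ˡ ys → T x y → T x′ y → x ≡ x′) →
           length xs ≤ length ys
length-≤ {T = T} {xs} {ys} xs! total injective = Fin.injective⇒≤ position-injective
  where
  position : Fin (length xs) → Fin (length ys)
  position i = Any.index (proj₁ (proj₂ (total (∈-lookup i))))

  related : ∀ i → T (lookup xs i) (lookup ys (position i))
  related i with y , y∈ys , t ← total (∈-lookup {xs = xs} i) =
    subst (T _) (lookup-index y∈ys) t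

  position-injective : ∀ {i j} → position i ≡ position j → i ≡ j
  position-injective {i} {j} eq = Unique-lookup-injective xs!
    (injective (∈-lookup i) (∈-lookup j) (∈-lookup (position j))
      (subst (λ k → T (lookup xs i) (lookup ys k)) eq (related i)) (related j))

-- The hypotheses make `T` a one-to-one correspondence between the entries. Working with a relation
-- instead of two inverse maps avoids computing round trips between codes of maps.
length-≡ : {T : A → B → Set} {xs : List A} {ys : List B} → Unique xs → Unique ys →
           (∀ {x} → x ∈ˡ xs → ∃[ y ] y ∈ˡ ys × T x y) →
           (∀ {y} → y ∈ˡ ys → ∃[ x ] x ∈ˡ xs × T x y) →
           (∀ {x x′ y} → x ∈ˡ xs → x′ ∈ˡ xs → y ∈ˡ ys → T x y → T x′ y → x ≡ x′) →
           (∀ {x y y′} → x ∈ˡ xs → y ∈ˡ ys → y′ ∈ˡ ys → T x y → T x y′ → y ≡ y′) →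
           length xs ≡ length ys
length-≡ {T = T} xs! ys! totalˡ totalʳ injective functional = ≤-antisym
  (length-≤ {T = T} xs! totalˡ injective)
  (length-≤ {T = λ y x → T x y} ys! totalʳ
    (λ y∈ y′∈ x∈ → functional x∈ y∈ y′∈))

-- Lists of pairs and their lengths.

module _ {B : A → Set} (f : ∀ x → List (B x)) where

  dependentPairs : List A → List (Σ A B)
  dependentPairs = concatMap (λ x → map (x ,_) (f x))

  length-dependentPairs : ∀ xs → length (dependentPairs xs) ≡ sum (map (length ∘ f) xs)
  length-dependentPairs []       = refl
  length-dependentPairs (x ∷ xs) = trans (length-++ (map {B = Σ A B} (x ,_) (f x)))
    (cong₂ _+_ (length-map {B = Σ A B} (x ,_) (f x)) (length-dependentPairs xs))

  ∈-dependentPairs⁺ : ∀ {xs x y} → x ∈ˡ xs → y ∈ˡ f x → (x , y) ∈ˡ dependentPairs xs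
  ∈-dependentPairs⁺ x∈xs y∈fx =
    ∈-concatMap⁺ (λ x → map (x ,_) (f x)) (lose x∈xs (∈-map⁺ (_ ,_) y∈fx))

  ∈-dependentPairs⁻ : ∀ xs {x y} → (x , y) ∈ˡ dependentPairs xs → x ∈ˡ xs × y ∈ˡ f x
  ∈-dependentPairs⁻ xs xy∈
    with x , x∈xs , xy∈map ← find (∈-concatMap⁻ (λ x → map (x ,_) (f x)) {xs = xs} xy∈)
    with y , y∈fx , refl ← ∈-map⁻ (x ,_) xy∈map = x∈xs , y∈fx

  dependentPairs-unique : ∀ {xs} → Unique xs → (∀ x → Unique (f x)) →
                          Unique (dependentPairs xs)
  dependentPairs-unique []            f! = []
  dependentPairs-unique {x ∷ xs} xs!@(_ ∷ xs′!) f! = Unique.++⁺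
    (Unique.map⁺ (λ { refl → refl }) (f! x))
    (dependentPairs-unique xs′! f!)
    (λ (p∈map , p∈rest) → disjoint p∈map p∈rest)
    where
    disjoint : ∀ {p} → p ∈ˡ map (x ,_) (f x) → ¬ p ∈ˡ dependentPairs xs
    disjoint p∈map p∈rest with _ , _ , refl ← ∈-map⁻ (x ,_) p∈map =
      Unique.Unique[x∷xs]⇒x∉xs xs! (proj₁ (∈-dependentPairs⁻ xs p∈rest))

length-cartesianProduct : (xs : List A) (ys : List B) →
                          length (cartesianProduct xs ys) ≡ length xs * length ys
length-cartesianProduct []       ys = refl
length-cartesianProduct (x ∷ xs) ys = trans (length-++ (map (x ,_) ys))
  (cong₂ _+_ (length-map (x ,_) ys) (length-cartesianProduct xs ys))

-- Sublists, subsets and the list of connected partitions.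

∈-sublists⁻ : ∀ xs {ys : List A} {y} → ys ∈ˡ sublists xs → y ∈ˡ ys → y ∈ˡ xs
∈-sublists⁻ []       (here refl) ()
∈-sublists⁻ (x ∷ xs) ys∈ y∈ys with ∈-++⁻ (sublists xs) ys∈
... | inj₁ ys∈xs = there (∈-sublists⁻ xs ys∈xs y∈ys)
... | inj₂ ys∈map with ∈-map⁻ (x ∷_) ys∈map | y∈ys
...   | _ , _    , refl | here refl = here refl
...   | _ , zs∈ , refl | there y∈zs = there (∈-sublists⁻ xs zs∈ y∈zs)

sublists-unique : {xs : List A} → Unique xs → Unique (sublists xs)
sublists-unique []  = [] ∷ []
sublists-unique {xs = x ∷ xs} xs!@(_ ∷ xs′!) = Unique.++⁺
  (sublists-unique xs′!)
  (Unique.map⁺ (λ { refl → refl }) (sublists-unique xs′!))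
  (λ (ys∈ , ys∈map) → disjoint ys∈ ys∈map)
  where
  disjoint : ∀ {ys} → ys ∈ˡ sublists xs → ¬ ys ∈ˡ map (x ∷_) (sublists xs)
  disjoint ys∈ ys∈map with _ , _ , refl ← ∈-map⁻ (x ∷_) ys∈map =
    Unique.Unique[x∷xs]⇒x∉xs xs! (∈-sublists⁻ xs ys∈ (here refl))

module _ {P : A → Set} (P? : Decidable P) where

  filter∈sublists : ∀ xs → filter P? xs ∈ˡ sublists xs
  filter∈sublists []       = here refl
  filter∈sublists (x ∷ xs) with P? x
  ... | yes _ = ∈-++⁺ʳ (sublists xs) (∈-map⁺ (x ∷_) (filter∈sublists xs))
  ... | no  _ = ∈-++⁺ˡ (filter∈sublists xs)

  -- A sublist keeps the order of `xs`, so without repetitions it is determined by its members. This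
  -- turns equality of partitions as sets of parts into equality of lists.
  sublist≡filter : ∀ {xs ys} → Unique xs → ys ∈ˡ sublists xs →
                   (∀ {x} → x ∈ˡ ys → P x) → (∀ {x} → x ∈ˡ xs → P x → x ∈ˡ ys) →
                   ys ≡ filter P? xs
  sublist≡filter {[]} _ (here refl) _ _ = refl
  sublist≡filter {x ∷ xs} xs!@(_ ∷ xs′!) ys∈ sound complete
    with ∈-++⁻ (sublists xs) ys∈
  ... | inj₁ ys∈xs = trans
    (sublist≡filter xs′! ys∈xs sound (complete ∘ there))
    -- If `x` satisfied `P`, completeness would put it into `ys`, a sublist of the tail, and `x`
    -- would occur twice.
    (sym (filter-reject P? λ px →
      Unique.Unique[x∷xs]⇒x∉xs xs! (∈-sublists⁻ xs ys∈xs (complete (here refl) px))))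
  ... | inj₂ ys∈map with zs , zs∈ , refl ← ∈-map⁻ (x ∷_) ys∈map = trans
    (cong (x ∷_) (sublist≡filter xs′! zs∈ (sound ∘ there) complete′))
    (sym (filter-accept P? (sound (here refl))))
    where
    complete′ : ∀ {z} → z ∈ˡ xs → P z → z ∈ˡ zs
    complete′ z∈xs pz with complete (there z∈xs) pz
    ... | here refl  = contradiction z∈xs (Unique.Unique[x∷xs]⇒x∉xs xs!)
    ... | there z∈zs = z∈zs

∈-allSubsets : ∀ {n} (p : Subset n) → p ∈ˡ allSubsets n
∈-allSubsets Vec.[]              = here refl
∈-allSubsets (outside Vec.∷ p) = ∈-++⁺ˡ (∈-map⁺ (outside Vec.∷_) (∈-allSubsets p))
∈-allSubsets (inside  Vec.∷ p) =
  ∈-++⁺ʳ (map (outside Vec.∷_) (allSubsets _)) (∈-map⁺ (inside Vec.∷_) (∈-allSubsets p))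

allSubsets-unique : ∀ n → Unique (allSubsets n)
allSubsets-unique zero    = [] ∷ []
allSubsets-unique (suc n) = Unique.++⁺
  (Unique.map⁺ ∷-injectiveʳ (allSubsets-unique n))
  (Unique.map⁺ ∷-injectiveʳ (allSubsets-unique n))
  (λ (p∈out , p∈in) → disjoint p∈out p∈in)
  where
  disjoint : ∀ {p} → p ∈ˡ map (outside Vec.∷_) (allSubsets n) →
             ¬ p ∈ˡ map (inside Vec.∷_) (allSubsets n)
  disjoint p∈out p∈in
    with _ , _ , refl ← ∈-map⁻ (outside Vec.∷_) p∈out
    with _ , _ , () ← ∈-map⁻ (inside Vec.∷_) p∈in

allPairs⁺ : {P : A → Set} {R : A → A → Set} →
            (∀ {x y} → P x → P y → x ≢ y → R x y) →
            ∀ {xs} → All P xs → Unique xs → AllPairs R xs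
allPairs⁺ r []         []          = []
allPairs⁺ r (px ∷ pxs) (x≢xs ∷ xs!) =
  All.zipWith (λ (py , x≢y) → r px py x≢y) (pxs , x≢xs) ∷ allPairs⁺ r pxs xs!

connectedPartitions-unique : ∀ F → Unique (connectedPartitions F)
connectedPartitions-unique F = Unique.filter⁺ (connectedPartition? F)
  (sublists-unique (allSubsets-unique (order F)))

∈-connectedPartitions⁻ : ∀ F {ℛ} → ℛ ∈ˡ connectedPartitions F → ConnectedPartition F ℛ
∈-connectedPartitions⁻ F ℛ∈ =
  proj₂ (∈-filter⁻ (connectedPartition? F) {xs = sublists (allSubsets (order F))} ℛ∈)

connectedPartition-isPartition : ∀ F {ℛ} → ℛ ∈ˡ connectedPartitions F → IsPartition ℛ
connectedPartition-isPartition F ℛ∈ = proj₁ (∈-connectedPartitions⁻ F ℛ∈)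

connectedPartition-connected : ∀ F {ℛ} → ℛ ∈ˡ connectedPartitions F →
                               All (λ R → Connected (F [ R ])) ℛ
connectedPartition-connected F ℛ∈ = proj₂ (∈-connectedPartitions⁻ F ℛ∈)

-- Homomorphisms and their codes.

module _ (F G : Graph) where

  private
    module F = Graph F
    module G = Graph G

  homs : List (Fin (order G ^ order F))
  homs = filter (isHom? F G ∘ decodeMap F G) (allFin (order G ^ order F))

  homs-unique : Unique homs
  homs-unique = Unique.filter⁺ _ (Unique.allFin⁺ _)

  ∈-homs⁺ : ∀ {c} → IsHom F G (decodeMap F G c) → c ∈ˡ homs
  ∈-homs⁺ = ∈-filter⁺ (isHom? F G ∘ decodeMap F G) (∈-allFin _)

  ∈-homs⁻ : ∀ {c} → c ∈ˡ homs → IsHom F G (decodeMap F G c)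
  ∈-homs⁻ c∈ = proj₂ (∈-filter⁻ (isHom? F G ∘ decodeMap F G) {xs = allFin _} c∈)

  encodeMap : (F.V → G.V) → Fin (order G ^ order F)
  encodeMap f = funToFin (G.index ∘ f ∘ F.vertex)

  decode-encode : ∀ f v → decodeMap F G (encodeMap f) v ≡ f v
  decode-encode f v = trans
    (cong G.vertex (Fin.finToFun-funToFin (G.index ∘ f ∘ F.vertex) (F.index v)))
    (trans (Inverse.strictlyInverseʳ (proj₂ G.finite) _)
           (cong f (Inverse.strictlyInverseʳ (proj₂ F.finite) v)))

  -- Maps are compared pointwise but counted through codes. A code is recovered by re-encoding its
  -- map, and `funToFin` respects pointwise equality.
  decode-injective : ∀ {c d} → (∀ v → decodeMap F G c v ≡ decodeMap F G d v) → c ≡ d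
  decode-injective {c} {d} eq = trans (sym (Fin.funToFin-finToFin {order F} c))
    (trans (funToFin-cong pointwise) (Fin.funToFin-finToFin {order F} d))
    where
    funToFin-cong : ∀ {m n} {f g : Fin m → Fin n} → (∀ i → f i ≡ g i) →
                    funToFin f ≡ funToFin g
    funToFin-cong {zero}  f≗g = refl
    funToFin-cong {suc m} f≗g =
      cong₂ combine (f≗g zero) (funToFin-cong (f≗g ∘ suc))

    pointwise : ∀ i → finToFun c i ≡ finToFun {order G} {order F} d i
    pointwise i = subst (λ j → finToFun c j ≡ finToFun {order G} {order F} d j)
      (Inverse.strictlyInverseˡ (proj₂ F.finite) i)
      (vertex-injective (eq (F.vertex i)))
      where
      vertex-injective : ∀ {i j} → G.vertex i ≡ G.vertex j → i ≡ j
      vertex-injective {i} {j} e = trans (sym (Inverse.strictlyInverseˡ (proj₂ G.finite) i))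
        (trans (cong G.index e) (Inverse.strictlyInverseˡ (proj₂ G.finite) j))

  isHom-cong : ∀ {f g} → (∀ v → f v ≡ g v) → IsHom F G f → IsHom F G g
  isHom-cong f≗g fHom u v u~v = subst₂ G._~_ (f≗g u) (f≗g v) (fHom u v u~v)

  ∈-homs-encode : ∀ {f} → IsHom F G f → encodeMap f ∈ˡ homs
  ∈-homs-encode fHom = ∈-homs⁺ (isHom-cong (sym ∘ decode-encode _) fHom)

-- Components of the subgraph of equally coloured edges.

module _ (F : Graph) {C : Set} (_≟_ : DecidableEquality C) (g : V F → C) where

  private
    module F = Graph F

  -- Characterises the components of the graph of edges `u ~ v` of `F` with `g u ≡ g v`.
  -- Connectedness may be asked in `F [ R ]` because every edge inside a monochromatic `R` has ends
  -- of equal colour. The conditions are decidable, so the components can be filtered out of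
  -- `allSubsets`.
  record IsComponent (R : VertexSet F) : Set where
    constructor mkComponent
    field
      nonempty      : Nonempty R
      connected     : Connected (F [ R ])
      monochromatic : ∀ u v → F.index u ∈ R → F.index v ∈ R → g u ≡ g v
      closed        : ∀ u v → F.index u ∈ R → u F.~ v → g u ≡ g v → F.index v ∈ R

  open IsComponent

  isComponent? : Decidable IsComponent
  isComponent? R = map′
    (λ (a , b , c , d) → mkComponent a b c d)
    (λ (mkComponent a b c d) → a , b , c , d)
    (nonempty? R
      ×-dec connected? (F [ R ])
      ×-dec (finite-all? F.finite λ u → finite-all? F.finite λ v →
               (F.index u ∈? R) →-dec (F.index v ∈? R) →-dec (g u ≟ g v))
      ×-dec (finite-all? F.finite λ u → finite-all? F.finite λ v →
               (F.index u ∈? R) →-dec (u F.~? v) →-dec (g u ≟ g v) →-dec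
               (F.index v ∈? R)))

  -- A walk inside `P` that starts at the common vertex never leaves `Q`: its edges join equal
  -- colours since `P` is monochromatic, and `Q` is closed under such edges.
  component-⊆ : ∀ {P Q i} → IsComponent P → IsComponent Q → i ∈ P → i ∈ Q → P ⊆ Q
  component-⊆ {P} {Q} cP cQ i∈P i∈Q {j} j∈P =
    subst (_∈ Q) (index-vertex j)
      (stay (subst (_∈ Q) (sym (index-vertex _)) i∈Q)
        (connected cP (_ , subst (_∈ P) (sym (index-vertex _)) i∈P)
                      (_ , subst (_∈ P) (sym (index-vertex _)) j∈P)))
    where
    index-vertex : ∀ i → F.index (F.vertex i) ≡ i
    index-vertex = Inverse.strictlyInverseˡ (proj₂ F.finite)

    stay : ∀ {x y} → F.index (proj₁ x) ∈ Q → Star (Graph._~_ (F [ P ])) x y →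
           F.index (proj₁ y) ∈ Q
    stay x∈Q ε = x∈Q
    stay {x} x∈Q (_◅_ {j = z} x~z path) = stay
      (closed cQ _ _ x∈Q x~z (monochromatic cP _ _ (proj₂ x) (proj₂ z))) path

  component-unique : ∀ {P Q i} → IsComponent P → IsComponent Q → i ∈ P → i ∈ Q → P ≡ Q
  component-unique cP cQ i∈P i∈Q =
    ⊆-antisym (component-⊆ cP cQ i∈P i∈Q) (component-⊆ cQ cP i∈Q i∈P)

  private
    -- The membership proofs at both ends are left arbitrary so that widened walks can be
    -- concatenated with others. On the empty walk the two proofs are identified by irrelevance.
    widen : ∀ {R S} → R ⊆ S → ∀ {x y} → Star (Graph._~_ (F [ R ])) x y →
            ∀ p q → Star (Graph._~_ (F [ S ])) (proj₁ x , p) (proj₁ y , q)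
    widen R⊆S {x} ε p q = subst (λ p → Star _ _ (proj₁ x , p)) ([]=-irrelevant p q) ε
    widen R⊆S (_◅_ {j = z} x~z path) p q = x~z ◅ widen R⊆S path (R⊆S (proj₂ z)) q

    -- As long as an equally coloured edge leaves `R`, its outer end is added, which keeps the set
    -- connected and monochromatic. The set grows strictly, so the process stops, and then the set
    -- is closed.
    grow : ∀ u R → F.index u ∈ R → Connected (F [ R ]) →
           (∀ v w → F.index v ∈ R → F.index w ∈ R → g v ≡ g w) →
           Acc _⊃_ R → ∃[ S ] IsComponent S × F.index u ∈ S
    grow u R u∈R conn mono (acc rec)
      with finite-any? F.finite (λ x → finite-any? F.finite (λ y →
             (F.index x ∈? R) ×-dec ¬? (F.index y ∈? R) ×-dec (x F.~? y) ×-dec (g x ≟ g y)))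
    ... | no ¬edge = R , mkComponent (_ , u∈R) conn mono closed′ , u∈R
      where
      closed′ : ∀ x y → F.index x ∈ R → x F.~ y → g x ≡ g y → F.index y ∈ R
      closed′ x y x∈R x~y gx≡gy with F.index y ∈? R
      ... | yes y∈R = y∈R
      ... | no  y∉R = contradiction (x , y , x∈R , y∉R , x~y , gx≡gy) ¬edge
    ... | yes (x , y , x∈R , y∉R , x~y , gx≡gy) =
      grow u S (p⊆p∪q _ u∈R)
        -- Any two vertices of `S` are joined through `x`, the end in `R` of the added edge.
        (λ v w → toX v ◅◅ Star.reverse F.~-sym (toX w))
        (λ v w v∈S w∈S → trans (sameAsX v v∈S) (sym (sameAsX w w∈S)))
        (rec (p⊆p∪q _ , F.index y , q⊆p∪q R _ (x∈⁅x⁆ _) , y∉R))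
      where
      S : VertexSet F
      S = R ∪ ⁅ F.index y ⁆

      toX : ∀ v → Star (Graph._~_ (F [ S ])) v (x , p⊆p∪q _ x∈R)
      toX (v , v∈S) with x∈p∪q⁻ R _ v∈S
      ... | inj₁ v∈R = widen (p⊆p∪q _) (conn (v , v∈R) (x , x∈R)) v∈S _
      ... | inj₂ v∈y with refl ← F.index-injective (x∈⁅y⁆⇒x≡y _ v∈y) = F.~-sym x~y ◅ ε

      sameAsX : ∀ v → F.index v ∈ S → g v ≡ g x
      sameAsX v v∈S with x∈p∪q⁻ R _ v∈S
      ... | inj₁ v∈R = mono v x v∈R x∈R
      ... | inj₂ v∈y with refl ← F.index-injective (x∈⁅y⁆⇒x≡y _ v∈y) = sym gx≡gy

  component-∋ : ∀ u → ∃[ R ] IsComponent R × F.index u ∈ R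
  component-∋ u = grow u ⁅ F.index u ⁆ (x∈⁅x⁆ _) conn mono (⊃-wellFounded _)
    where
    only : ∀ {v} → F.index v ∈ ⁅ F.index u ⁆ → v ≡ u
    only v∈u = F.index-injective (x∈⁅y⁆⇒x≡y _ v∈u)

    conn : Connected (F [ ⁅ F.index u ⁆ ])
    conn (v , p) (w , q) with refl ← only p with refl ← only q =
      subst (λ q → Star _ _ (u , q)) ([]=-irrelevant p q) ε

    mono : ∀ v w → F.index v ∈ ⁅ F.index u ⁆ → F.index w ∈ ⁅ F.index u ⁆ → g v ≡ g w
    mono v w p q = cong g (trans (only p) (sym (only q)))

  components : List (VertexSet F)
  components = filter isComponent? (allSubsets (order F))

  ∈-components⁺ : ∀ {R} → IsComponent R → R ∈ˡ components
  ∈-components⁺ = ∈-filter⁺ isComponent? (∈-allSubsets _)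

  ∈-components⁻ : ∀ {R} → R ∈ˡ components → IsComponent R
  ∈-components⁻ R∈ = proj₂ (∈-filter⁻ isComponent? {xs = allSubsets _} R∈)

  components-partition : IsPartition components
  components-partition = mkPartition
    (All.tabulate λ R∈ → nonempty (∈-components⁻ R∈))
    (allPairs⁺ {P = IsComponent} disjoint
       (All.tabulate ∈-components⁻)
       (Unique.filter⁺ isComponent? (allSubsets-unique (order F))))
    covering
    where
    disjoint : ∀ {P Q} → IsComponent P → IsComponent Q → P ≢ Q → Empty (P ∩ Q)
    disjoint {P} {Q} cP cQ P≢Q (i , i∈) =
      let i∈P , i∈Q = x∈p∩q⁻ P Q i∈ in P≢Q (component-unique cP cQ i∈P i∈Q)

    covering : ∀ i → Any.Any (i ∈_) components
    covering i = let R , cR , i∈R = component-∋ (F.vertex i) in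
      lose (∈-components⁺ cR)
        (subst (_∈ R) (Inverse.strictlyInverseˡ (proj₂ F.finite) i) i∈R)

  components-connected : All (λ R → Connected (F [ R ])) components
  components-connected = All.tabulate λ R∈ → connected (∈-components⁻ R∈)

  components∈connectedPartitions : components ∈ˡ connectedPartitions F
  components∈connectedPartitions = ∈-filter⁺ (connectedPartition? F)
    {xs = sublists (allSubsets (order F))}
    (filter∈sublists isComponent? (allSubsets (order F)))
    (components-partition , components-connected)

  -- Only one inclusion has to be supplied. Conversely, a component has a vertex, that vertex lies
  -- in some part by covering, and the part is itself a component, hence the same one.
  ≡components : ∀ {ℛ} → ℛ ∈ˡ connectedPartitions F →
                (∀ {R} → R ∈ˡ ℛ → IsComponent R) → ℛ ≡ components
  ≡components {ℛ} ℛ∈ sound =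
    let ℛ∈sublists , partition , _ = ∈-filter⁻ (connectedPartition? F)
          {xs = sublists (allSubsets (order F))} ℛ∈
    in sublist≡filter isComponent? (allSubsets-unique (order F)) ℛ∈sublists sound
         (λ _ → complete partition)
    where
    complete : IsPartition ℛ → ∀ {R} → IsComponent R → R ∈ˡ ℛ
    complete partition cR =
      let i , i∈R       = nonempty cR
          P , P∈ℛ , i∈P = find (IsPartition.covering partition i)
      in subst (_∈ˡ ℛ) (component-unique (sound P∈ℛ) cR i∈P i∈R) P∈ℛ

-- Locating vertices in the parts of a partition.

module _ (F : Graph) {ℛ : List (VertexSet F)} (partition : IsPartition ℛ) where

  private
    module F = Graph F

  open IsPartition partition

  part-unique : ∀ {i P Q} → i ∈ lookup ℛ P → i ∈ lookup ℛ Q → P ≡ Q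
  part-unique {i} {P} {Q} i∈P i∈Q with P Fin.≟ Q
  ... | yes P≡Q = P≡Q
  ... | no  P≢Q = contradiction (i , x∈p∩q⁺ (i∈P , i∈Q))
    (AllPairs-lookup (λ {S} {T} → disjoint-sym {S} {T}) disjoint P≢Q)
    where
    disjoint-sym : Symmetric (λ S T → Empty (S ∩ T))
    disjoint-sym {S} {T} ¬S∩T (j , j∈) =
      ¬S∩T (j , x∈p∩q⁺ (proj₂ (x∈p∩q⁻ T S j∈) , proj₁ (x∈p∩q⁻ T S j∈)))

  -- Inverse to forgetting the part: the vertices of `∐-parts F ℛ` are those of `F`, each tagged
  -- with the part containing it.
  locate : F.V → V (∐-parts F ℛ)
  locate v = Any.index (covering (F.index v)) , v , lookup-index (covering (F.index v))

  locate-unique : ∀ x → locate (proj₁ (proj₂ x)) ≡ x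
  -- Generalising over `locate v` leaves its part a variable, so that `part-unique` can be matched
  -- with `refl`.
  locate-unique (P , v , v∈P) = helper (locate v) refl
    where
    helper : (y : V (∐-parts F ℛ)) → proj₁ (proj₂ y) ≡ v → y ≡ (P , v , v∈P)
    helper (Q , v , v∈Q) refl with refl ← part-unique v∈Q v∈P =
      cong (λ p → P , v , p) ([]=-irrelevant v∈Q v∈P)

  representative : ∀ P → Σ[ v ∈ F.V ] F.index v ∈ lookup ℛ P
  representative P with i , i∈P ← All.lookup nonempty (∈-lookup P) =
    F.vertex i , subst (_∈ lookup ℛ P) (sym (Inverse.strictlyInverseˡ (proj₂ F.finite) i)) i∈P

-- Gluing and splitting homomorphisms.

module _ (F G H : Graph) where

  private
    module F = Graph F
    module G = Graph G
    module H = Graph H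

  -- Quantifying over the disjoint union supplies each vertex together with its part, so the
  -- relation makes sense before `ℛ` is known to be a partition.
  Glues : (ℛ : List (VertexSet F)) (f : F.V → V (G · H))
          (f₁ : V (F / ℛ) → G.V) (f₂ : V (∐-parts F ℛ) → H.V) → Set
  Glues ℛ f f₁ f₂ = ∀ x → f (proj₁ (proj₂ x)) ≡ (f₁ (proj₁ x) , f₂ x)

  module _ {ℛ f f₁ f₂} (partition : IsPartition ℛ) (glues : Glues ℛ f f₁ f₂) where

    -- An edge inside a part keeps its `G`-coordinate and goes to an edge of `H`; an edge between
    -- parts is an edge of `F / ℛ` and goes to an edge of `G`.
    glued-isHom : IsHom (F / ℛ) G f₁ → IsHom (∐-parts F ℛ) H f₂ → IsHom F (G · H) f
    glued-isHom hom₁ hom₂ u v u~v =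
      subst₂ (Graph._~_ (G · H)) (sym (glues x)) (sym (glues y)) (adjacent x y u~v)
      where
      x = locate F partition u
      y = locate F partition v

      -- Stated for arbitrary tagged vertices, so that equality of the two parts can be matched with
      -- `refl`.
      adjacent : ∀ x y → proj₁ (proj₂ x) F.~ proj₁ (proj₂ y) →
                 Graph._~_ (G · H) (f₁ (proj₁ x) , f₂ x) (f₁ (proj₁ y) , f₂ y)
      adjacent x@(P , u , u∈P) y@(Q , v , v∈Q) u~v with P Fin.≟ Q
      ... | yes refl = inj₁ (refl , hom₂ x y (within P u~v))
      ... | no  P≢Q  = inj₂ (hom₁ P Q (P≢Q , u , v , u∈P , v∈Q , u~v))

    -- Closedness rests on `G` having no loops: an edge of `F` leaving the part gives an edge of
    -- `F / ℛ`, whose ends `f₁` sends to adjacent and therefore distinct vertices of `G`.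
    part-isComponent : Simple G → All (λ R → Connected (F [ R ])) ℛ → IsHom (F / ℛ) G f₁ →
                       ∀ P → IsComponent F G._≟_ (proj₁ ∘ f) (lookup ℛ P)
    part-isComponent G-simple conn hom₁ P = mkComponent
      (All.lookup (IsPartition.nonempty partition) (∈-lookup P))
      (All.lookup conn (∈-lookup P))
      (λ u v u∈P v∈P → trans (colour (P , u , u∈P)) (sym (colour (P , v , v∈P))))
      (λ u v u∈P u~v eq → closed (locate F partition v) u∈P u~v eq)
      where
      colour : ∀ x → proj₁ (f (proj₁ (proj₂ x))) ≡ f₁ (proj₁ x)
      colour x = cong proj₁ (glues x)

      closed : ∀ y {u} → F.index u ∈ lookup ℛ P → u F.~ proj₁ (proj₂ y) →
               proj₁ (f u) ≡ proj₁ (f (proj₁ (proj₂ y))) →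
               F.index (proj₁ (proj₂ y)) ∈ lookup ℛ P
      closed y@(Q , v , v∈Q) {u} u∈P u~v eq with P Fin.≟ Q
      ... | yes refl = v∈Q
      ... | no  P≢Q  = contradiction (hom₁ P Q (P≢Q , u , v , u∈P , v∈Q , u~v))
        (G-simple (trans (sym (colour (P , u , u∈P))) (trans eq (colour y))))

    -- Recovers the partition from the glued map alone, which makes the summand containing a given
    -- homomorphism unique.
    glues-components : Simple G → ℛ ∈ˡ connectedPartitions F → IsHom (F / ℛ) G f₁ →
                       ℛ ≡ components F G._≟_ (proj₁ ∘ f)
    glues-components G-simple ℛ∈ hom₁ = ≡components F G._≟_ (proj₁ ∘ f) ℛ∈ λ R∈ℛ →
      subst (IsComponent F G._≟_ (proj₁ ∘ f)) (sym (lookup-index R∈ℛ))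
        (part-isComponent G-simple (connectedPartition-connected F ℛ∈) hom₁
          (Any.index R∈ℛ))

  module _ (G-simple : Simple G) {f : F.V → V (G · H)} (f-hom : IsHom F (G · H) f)
           {ℛ} (partition : IsPartition ℛ)
           (component : ∀ P → IsComponent F G._≟_ (proj₁ ∘ f) (lookup ℛ P)) where

    quotientMap : V (F / ℛ) → G.V
    quotientMap P = proj₁ (f (proj₁ (representative F partition P)))

    restriction : V (∐-parts F ℛ) → H.V
    restriction x = proj₂ (f (proj₁ (proj₂ x)))

    -- The choice of representative does not matter, since a component is monochromatic.
    quotientMap-colour : ∀ {P v} → F.index v ∈ lookup ℛ P → proj₁ (f v) ≡ quotientMap P
    quotientMap-colour {P} v∈P = IsComponent.monochromatic (component P) _ _ v∈P
      (proj₂ (representative F partition P))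

    glues-restriction : Glues ℛ f quotientMap restriction
    glues-restriction (P , v , v∈P) = cong (_, proj₂ (f v)) (quotientMap-colour v∈P)

    -- An edge of `F` between different parts cannot have ends of equal colour, since closedness
    -- would put both ends into one part. Its image is therefore an edge in the `G`-coordinate.
    quotientMap-isHom : IsHom (F / ℛ) G quotientMap
    quotientMap-isHom P Q (P≢Q , p , q , p∈P , q∈Q , p~q) with f-hom p q p~q
    ... | inj₁ (eq , _) = contradiction
      (part-unique F partition (IsComponent.closed (component P) p q p∈P p~q eq) q∈Q) P≢Q
    ... | inj₂ adj = subst₂ G._~_ (quotientMap-colour p∈P) (quotientMap-colour q∈Q) adj

    -- Both ends of an edge inside a part have the same colour, so an edge in the `G`-coordinate
    -- would be a loop.
    restriction-isHom : IsHom (∐-parts F ℛ) H restriction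
    restriction-isHom (P , u , u∈P) (P , v , v∈P) (within P u~v) with f-hom u v u~v
    ... | inj₁ (_ , adj) = adj
    ... | inj₂ adj =
      contradiction adj (G-simple (IsComponent.monochromatic (component P) u v u∈P v∈P))

  -- Counting partitions together with pairs of homomorphisms.

  Code : List (VertexSet F) → Set
  Code ℛ = Fin (order G ^ order (F / ℛ)) × Fin (order H ^ order (∐-parts F ℛ))

  homPairs : ∀ ℛ → List (Code ℛ)
  homPairs ℛ = cartesianProduct (homs (F / ℛ) G) (homs (∐-parts F ℛ) H)

  -- The set counted by the right-hand side. The pairs are dependent because the number of possible
  -- codes varies with `ℛ`.
  gluingData : List (Σ (List (VertexSet F)) Code)
  gluingData = dependentPairs homPairs (connectedPartitions F)

  gluingData-unique : Unique gluingData
  gluingData-unique = dependentPairs-unique homPairs (connectedPartitions-unique F) λ ℛ →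
    Unique.cartesianProduct⁺ (homs-unique (F / ℛ) G) (homs-unique (∐-parts F ℛ) H)

  length-gluingData : length gluingData ≡
    sum (map (λ ℛ → hom (F / ℛ) G * hom (∐-parts F ℛ) H) (connectedPartitions F))
  length-gluingData = trans (length-dependentPairs homPairs (connectedPartitions F))
    (cong sum (map-cong (λ ℛ → length-cartesianProduct (homs (F / ℛ) G) (homs (∐-parts F ℛ) H))
                        (connectedPartitions F)))

  ∈-gluingData⁺ : ∀ {ℛ c₁ c₂} → ℛ ∈ˡ connectedPartitions F →
                  c₁ ∈ˡ homs (F / ℛ) G → c₂ ∈ˡ homs (∐-parts F ℛ) H →
                  (ℛ , c₁ , c₂) ∈ˡ gluingData
  ∈-gluingData⁺ ℛ∈ c₁∈ c₂∈ = ∈-dependentPairs⁺ homPairs ℛ∈ (∈-cartesianProduct⁺ c₁∈ c₂∈)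

  ∈-gluingData⁻ : ∀ {ℛ c₁ c₂} → (ℛ , c₁ , c₂) ∈ˡ gluingData →
                  ℛ ∈ˡ connectedPartitions F ×
                  c₁ ∈ˡ homs (F / ℛ) G × c₂ ∈ˡ homs (∐-parts F ℛ) H
  ∈-gluingData⁻ {ℛ} ∈data =
    let ℛ∈ , c∈ = ∈-dependentPairs⁻ homPairs (connectedPartitions F) ∈data
    in ℛ∈ , ∈-cartesianProduct⁻ (homs (F / ℛ) G) (homs (∐-parts F ℛ) H) c∈

  CodeGlues : Fin (order (G · H) ^ order F) → Σ (List (VertexSet F)) Code → Set
  CodeGlues c (ℛ , c₁ , c₂) =
    Glues ℛ (decodeMap F (G · H) c) (decodeMap (F / ℛ) G c₁) (decodeMap (∐-parts F ℛ) H c₂)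

  -- The partition is the one into components for the `G`-coordinate of the decoded map.
  split : Simple G → ∀ {c} → c ∈ˡ homs F (G · H) → ∃[ d ] d ∈ˡ gluingData × CodeGlues c d
  split G-simple {c} c∈ =
    (ℛ , encodeMap (F / ℛ) G f₁ , encodeMap (∐-parts F ℛ) H f₂) ,
    ∈-gluingData⁺ (components∈connectedPartitions F G._≟_ (proj₁ ∘ f))
      (∈-homs-encode (F / ℛ) G (quotientMap-isHom G-simple f-hom partition component))
      (∈-homs-encode (∐-parts F ℛ) H (restriction-isHom G-simple f-hom partition component)) ,
    λ x → trans (glues-restriction G-simple f-hom partition component x)
      (sym (cong₂ _,_ (decode-encode (F / ℛ) G f₁ (proj₁ x))
                      (decode-encode (∐-parts F ℛ) H f₂ x)))
    where
    f         = decodeMap F (G · H) c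
    f-hom     = ∈-homs⁻ F (G · H) c∈
    ℛ         = components F G._≟_ (proj₁ ∘ f)
    partition = components-partition F G._≟_ (proj₁ ∘ f)

    component : ∀ P → IsComponent F G._≟_ (proj₁ ∘ f) (lookup ℛ P)
    component P = ∈-components⁻ F G._≟_ (proj₁ ∘ f) (∈-lookup P)

    f₁ = quotientMap G-simple f-hom partition component
    f₂ = restriction G-simple f-hom partition component

  glue : ∀ {d} → d ∈ˡ gluingData → ∃[ c ] c ∈ˡ homs F (G · H) × CodeGlues c d
  glue {ℛ , c₁ , c₂} d∈ =
    let ℛ∈ , c₁∈ , c₂∈ = ∈-gluingData⁻ d∈
        partition = connectedPartition-isPartition F ℛ∈
        f₁ = decodeMap (F / ℛ) G c₁
        f₂ = decodeMap (∐-parts F ℛ) H c₂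

        f : F.V → V (G · H)
        f v = f₁ (proj₁ (locate F partition v)) , f₂ (locate F partition v)

        -- By definition `f` reads off its values at the located vertex, and locating the underlying
        -- vertex of `x` returns `x`.
        glues : Glues ℛ f f₁ f₂
        glues x = cong (λ y → f₁ (proj₁ y) , f₂ y) (locate-unique F partition x)

        f-hom = glued-isHom partition glues
          (∈-homs⁻ (F / ℛ) G c₁∈) (∈-homs⁻ (∐-parts F ℛ) H c₂∈)
    in encodeMap F (G · H) f , ∈-homs-encode F (G · H) f-hom ,
       λ x → trans (decode-encode F (G · H) f (proj₁ (proj₂ x))) (glues x)

  codeGlues-injective : ∀ {c c′ d} → d ∈ˡ gluingData →
                        CodeGlues c d → CodeGlues c′ d → c ≡ c′
  codeGlues-injective {d = ℛ , c₁ , c₂} d∈ glues glues′ = decode-injective F (G · H) λ v →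
    let x = locate F (connectedPartition-isPartition F (proj₁ (∈-gluingData⁻ d∈))) v
    in trans (glues x) (sym (glues′ x))

  -- Every part has a vertex, at which the first coordinate of the glued map gives the value of the
  -- quotient map; the second coordinate gives the other map at every vertex of the disjoint union.
  glues-functional : ∀ {ℛ c c₁ c₁′ c₂ c₂′} → IsPartition ℛ →
                     CodeGlues c (ℛ , c₁ , c₂) → CodeGlues c (ℛ , c₁′ , c₂′) →
                     (c₁ , c₂) ≡ (c₁′ , c₂′)
  glues-functional {ℛ} partition glues glues′ = cong₂ _,_
    (decode-injective (F / ℛ) G λ P →
      let x = P , representative F partition P
      in cong proj₁ (trans (sym (glues x)) (glues′ x)))
    (decode-injective (∐-parts F ℛ) H λ x →
      cong proj₂ (trans (sym (glues x)) (glues′ x)))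

  codeGlues-functional : Simple G → ∀ {c d d′} → d ∈ˡ gluingData → d′ ∈ˡ gluingData →
                         CodeGlues c d → CodeGlues c d′ → d ≡ d′
  codeGlues-functional G-simple {c} {ℛ , c₁ , c₂} {ℛ′ , c₁′ , c₂′} d∈ d′∈ glues glues′ =
    -- Both partitions consist of the components of the same decoded map. The types of the codes
    -- depend on the partition, so the partitions are identified before the codes are compared.
    samePartition (trans (≡comps d∈ glues) (sym (≡comps d′∈ glues′))) glues′
    where
    ≡comps : ∀ {ℛ c₁ c₂} → (ℛ , c₁ , c₂) ∈ˡ gluingData → CodeGlues c (ℛ , c₁ , c₂) →
             ℛ ≡ components F G._≟_ (proj₁ ∘ decodeMap F (G · H) c)
    ≡comps {ℛ} d∈ glues =
      let ℛ∈ , c₁∈ , _ = ∈-gluingData⁻ d∈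
      in glues-components (connectedPartition-isPartition F ℛ∈) glues G-simple ℛ∈
           (∈-homs⁻ (F / ℛ) G c₁∈)

    samePartition : ∀ {ℛ′ c₁′ c₂′} → ℛ ≡ ℛ′ → CodeGlues c (ℛ′ , c₁′ , c₂′) →
                    (ℛ , c₁ , c₂) ≡ (ℛ′ , c₁′ , c₂′)
    samePartition refl glues′ = cong (ℛ ,_)
      (glues-functional (connectedPartition-isPartition F (proj₁ (∈-gluingData⁻ d∈)))
        glues glues′)

theorem16 : (F G H : Graph) → Simple F → Simple G → Simple H →
  hom F (G · H) ≡
  sum (map (λ ℛ → hom (F / ℛ) G * hom (∐-parts F ℛ) H) (connectedPartitions F))
theorem16 F G H _ G-simple _ = trans
  (length-≡ {T = CodeGlues F G H}
    (homs-unique F (G · H))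
    (gluingData-unique F G H)
    (split F G H G-simple)
    (glue F G H)
    (λ _ _ d∈ → codeGlues-injective F G H d∈)
    (λ _ d∈ d′∈ → codeGlues-functional F G H G-simple d∈ d′∈))
  (length-gluingData F G H)
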